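{- For all barriers $B$, $\mathsf{TS}^B\leq_{\mathrm{sW}}\mathsf{FS}^B$.
   Context: $\mathbb{N}$ is the set of natural numbers (including $0$). Subsets of $\mathbb{N}$ are identified with their strictly increasing enumerations; $s\sqsubset Y$ means that $s$ is a proper initial segment of $Y$ as a sequence; $\subset$ is strict set inclusion. A set $B$ of finite subsets of $\mathbb{N}$ is a barrier on an infinite set $X\subseteq\mathbb{N}$ if: (1) $\bigcup B=X$; (2) for all $s,t\in B$, $s\not\subset t$; (3) for every infinite $Y\subseteq X$ there is $s\in B$ with $s\sqsubset Y$. The set $X=\bigcup B$ is the base of $B$. For infinite $Y\subseteq X$, $B\vert Y=\{s\in B: s\subseteq Y\}$ (this is a barrier on $Y$, and every barrier $B'\subseteq B$ has this form). $\mathsf{TS}^B$ is the problem whose instances are the functions $f:B\to\mathbb{N}$, where a solution to $f$ is an infinite $Y$ contained in the base of $B$ such that $f(B\vert Y)\neq\mathbb{N}$. $\mathsf{FS}^B$ is the problem whose instances are the functions $f:B\to\mathbb{N}$, where a solution to $f$ is an infinite $Y$ contained in the base of $B$ such that for all $s\in B\vert Y$, if $f(s)\in Y$ then $f(s)\in s$. Instances and solutions are coded as subsets of $\mathbb{N}$ in a standard way, a coloring being given together with its domain (so that the barrier is uniformly computable from a coloring of it). For such problems $\mathsf{P},\mathsf{Q}$, $\mathsf{Q}\leq_{\mathrm{sW}}\mathsf{P}$ (strong Weihrauch reducibility) means: there are Turing functionals $\Phi,\Psi$ such that for every instance $I$ of $\mathsf{Q}$, $\Phi(I)$ is an instance of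 $\mathsf{P}$, and for every solution $\hat Y$ to $\Phi(I)$, $\Psi(\hat Y)$ is a solution to $I$ for $\mathsf{Q}$. -}

module Defs where

open import Data.Bool.Base using (Bool; T; if_then_else_)
open import Data.Fin.Base using (Fin)
open import Data.List.Base using (List; applyUpTo; map)
open import Data.List.Membership.Propositional using () renaming (_∈_ to _∈ˡ_)
open import Data.List.Relation.Unary.Linked using (Linked)
open import Data.Nat.Base using (ℕ; zero; suc; _+_; _*_; _^_; _/_; _≤_; _<_)
open import Data.Nat.ListAction using (sum)
open import Data.Product.Base using (Σ; ∃; ∃-syntax; _×_; proj₁)
open import Data.Refinement using (Refinement-syntax; value)
open import Data.Vec.Base using (Vec; []; _∷_; lookup)
open import Data.Vec.Relation.Binary.Pointwise.Inductive using (Pointwise)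
open import Function.Bundles using (_⇔_)
open import Level using (0ℓ)
open import Relation.Binary.Core using (_Preserves_⟶_)
open import Relation.Binary.PropositionalEquality.Core using (_≡_)
open import Relation.Nullary.Negation.Core using (¬_)
open import Relation.Unary using (Pred; _∈_; _⊆_; _⊂_; _≐_; U)

infix 4 _⊏_ _IsBarrierOn_ _≤sW_ _⟪_⟫≡_ _⊢_[_]⇓_
infix 8 _↾_

-- Sets of natural numbers.  Those which are inputs, oracles or outputs of
-- computations are points of Cantor space; in the definition of a barrier, the
-- base and the barrier itself are arbitrary predicates.

Cantor : Set
Cantor = ℕ → Bool

⟦_⟧ : Cantor → Pred ℕ 0ℓ
⟦ Y ⟧ n = T (Y n)

Infinite : Pred ℕ 0ℓ → Set
Infinite P = ∀ n → ∃[ m ] n ≤ m × m ∈ P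

-- Finite sets are given by their strictly increasing enumerations.

FinSet : Set
FinSet = [ xs ∈ List ℕ ∣ Linked _<_ xs ]

elems : FinSet → Pred ℕ 0ℓ
elems s n = n ∈ˡ value s

_Enumerates_ : (ℕ → ℕ) → Cantor → Set
e Enumerates Y = e Preserves _<_ ⟶ _<_ × (∀ n → n ∈ ⟦ Y ⟧ ⇔ (∃[ i ] e i ≡ n))

-- For infinite Y; a finite initial segment is then automatically proper.

_⊏_ : FinSet → Cantor → Set
s ⊏ Y = ∃[ e ] e Enumerates Y × (∃[ k ] value s ≡ applyUpTo e k)

⋃ : Pred FinSet 0ℓ → Pred ℕ 0ℓ
⋃ B n = ∃[ s ] s ∈ B × n ∈ elems s

record _IsBarrierOn_ (B : Pred FinSet 0ℓ) (X : Pred ℕ 0ℓ) : Set where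
  field
    infinite  : Infinite X
    base      : ⋃ B ≐ X
    antichain : ∀ {s t} → s ∈ B → t ∈ B → ¬ (elems s ⊂ elems t)
    bar       : ∀ Y → Infinite ⟦ Y ⟧ → ⟦ Y ⟧ ⊆ X → ∃[ s ] s ∈ B × s ⊏ Y

_↾_ : Pred FinSet 0ℓ → Cantor → Pred FinSet 0ℓ
(B ↾ Y) s = s ∈ B × elems s ⊆ ⟦ Y ⟧

-- The membership proof is irrelevant, so that a coloring is a function of s.

Coloring : Pred FinSet 0ℓ → Set
Coloring B = ∀ s → .(s ∈ B) → ℕ

-- f(B ↾ Y)

image : ∀ {B} → Coloring B → Cantor → Pred ℕ 0ℓ
image {B} f Y n = ∃[ s ] Σ (s ∈ B ↾ Y) λ m → f s (proj₁ m) ≡ n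

-- Partial recursive functionals: the μ-recursive functions relative to an
-- oracle A, with a big-step semantics.

data Rec : ℕ → Set where
  zeroᶠ   : Rec 0
  sucᶠ    : Rec 1
  oracleᶠ : Rec 1
  projᶠ   : ∀ {n} → Fin n → Rec n
  compᶠ   : ∀ {m n} → Rec m → Vec (Rec n) m → Rec n
  precᶠ   : ∀ {n} → Rec n → Rec (2 + n) → Rec (1 + n)
  μᶠ      : ∀ {n} → Rec (1 + n) → Rec n

χ : Cantor → ℕ → ℕ
χ A n = if A n then 1 else 0

data _⊢_[_]⇓_ (A : Cantor) : ∀ {n} → Rec n → Vec ℕ n → ℕ → Set where
  ⇓zero   : A ⊢ zeroᶠ [ [] ]⇓ 0
  ⇓suc    : ∀ {x} → A ⊢ sucᶠ [ x ∷ [] ]⇓ suc x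
  ⇓oracle : ∀ {x} → A ⊢ oracleᶠ [ x ∷ [] ]⇓ χ A x
  ⇓proj   : ∀ {n} {i : Fin n} {xs} → A ⊢ projᶠ i [ xs ]⇓ lookup xs i
  ⇓comp   : ∀ {m n} {f : Rec m} {gs : Vec (Rec n) m} {xs ys z} →
            Pointwise (λ g y → A ⊢ g [ xs ]⇓ y) gs ys →
            A ⊢ f [ ys ]⇓ z →
            A ⊢ compᶠ f gs [ xs ]⇓ z
  ⇓prec₀  : ∀ {n} {f : Rec n} {g : Rec (2 + n)} {xs z} →
            A ⊢ f [ xs ]⇓ z →
            A ⊢ precᶠ f g [ zero ∷ xs ]⇓ z
  ⇓prec₁  : ∀ {n} {f : Rec n} {g : Rec (2 + n)} {k xs y z} →
            A ⊢ precᶠ f g [ k ∷ xs ]⇓ y →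
            A ⊢ g [ k ∷ y ∷ xs ]⇓ z →
            A ⊢ precᶠ f g [ suc k ∷ xs ]⇓ z
  ⇓μ      : ∀ {n} {f : Rec (1 + n)} {xs k} →
            (∀ i → i < k → ∃[ y ] A ⊢ f [ i ∷ xs ]⇓ suc y) →
            A ⊢ f [ k ∷ xs ]⇓ 0 →
            A ⊢ μᶠ f [ xs ]⇓ k

Functional : Set
Functional = Rec 1

_⟪_⟫≡_ : Functional → Cantor → Cantor → Set
Φ ⟪ A ⟫≡ Y = ∀ n → A ⊢ Φ [ n ∷ [] ]⇓ χ Y n

record Problem : Set₁ where
  field
    Instance : Set
    Codes    : Cantor → Instance → Set
    Solution : Instance → Pred Cantor 0ℓ

_≤sW_ : Problem → Problem → Set
Q ≤sW P = ∃[ Φ ] ∃[ Ψ ] ∀ I p → Q.Codes p I →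
  ∃[ J ] ∃[ q ] Φ ⟪ p ⟫≡ q × P.Codes q J ×
    (∀ Ŷ → Ŷ ∈ P.Solution J → ∃[ Y ] Ψ ⟪ Ŷ ⟫≡ Y × Y ∈ Q.Solution I)
  where
  module Q = Problem Q
  module P = Problem P

-- Canonical index Σ { 2ⁿ ∣ n ∈ s } of a finite set

index : FinSet → ℕ
index s = sum (map (2 ^_) (value s))

-- Cantor pairing

pair : ℕ → ℕ → ℕ
pair a b = (a + b) * suc (a + b) / 2 + b

-- A coloring is coded by the join of its domain and its graph.

record CodesColoring {B} (p : Cantor) (f : Coloring B) : Set where
  field
    domain : ∀ n → 2 * n ∈ ⟦ p ⟧ ⇔ (∃[ s ] s ∈ B × index s ≡ n)
    graph  : ∀ n → 1 + 2 * n ∈ ⟦ p ⟧ ⇔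
               (∃[ s ] Σ (s ∈ B) λ b → pair (index s) (f s b) ≡ n)

TS : Pred FinSet 0ℓ → Problem
TS B = record
  { Instance = Coloring B
  ; Codes    = CodesColoring
  ; Solution = λ f Y → Infinite ⟦ Y ⟧ × ⟦ Y ⟧ ⊆ ⋃ B × ¬ (image f Y ≐ U)
  }

FS : Pred FinSet 0ℓ → Problem
FS B = record
  { Instance = Coloring B
  ; Codes    = CodesColoring
  ; Solution = λ f Y → Infinite ⟦ Y ⟧ × ⟦ Y ⟧ ⊆ ⋃ B ×
      (∀ s (m : s ∈ B ↾ Y) → f s (proj₁ m) ∈ ⟦ Y ⟧ → f s (proj₁ m) ∈ elems s)
  }

{-# OPTIONS --safe #-}

-- Let Ŷ be free for f, and let Y be Ŷ without its minimum a.  If f s = a for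
-- some s ⊆ Y, then freeness gives a ∈ s ⊆ Y, which is absurd: f omits a on Y.
-- So the forward functional is the identity and the backward one removes the
-- minimum.  The minimum itself is never computed: an element of Ŷ belongs to Y
-- when Ŷ has a smaller element, and the contradiction is an infinite descent.

module Submission where

open import Defs
open import Data.Bool.Base using (Bool; true; false; _∧_; _∨_; if_then_else_)
open import Data.Bool.Properties using (T-∧; T-∨)
open import Data.Fin.Patterns using (0F; 1F; 2F)
open import Data.Nat.Base using (ℕ; zero; suc; _<_; _⊔_; s≤s⁻¹)
open import Data.Nat.Induction using (<-rec)
open import Data.Nat.Properties using (m<n⇒m<1+n; m≤n⇒m<n∨m≡n; m⊔n≤o⇒m≤o; m⊔n≤o⇒n≤o; n<1+n)
open import Data.Product.Base using (∃-syntax; _×_; _,_; proj₁; proj₂)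
open import Data.Sum.Base using (inj₁; inj₂)
open import Data.Unit.Base using (tt)
open import Data.Vec.Base using ([]; _∷_)
open import Data.Vec.Relation.Binary.Pointwise.Inductive using ([]; _∷_)
open import Function.Base using (_∘_)
open import Function.Bundles using (module Equivalence)
open import Level using (0ℓ)
open import Relation.Binary.PropositionalEquality.Core using (refl)
open import Relation.Nullary.Negation.Core using (¬_)
open import Relation.Unary using (Pred; _∈_; _⊆_; _≐_; U)

open Equivalence using (to; from)

hasBelow : Cantor → Cantor
hasBelow Y zero    = false
hasBelow Y (suc n) = hasBelow Y n ∨ Y n

removeMin : Cantor → Cantor
removeMin Y n = Y n ∧ hasBelow Y n

hasBelow⁻ : ∀ Y n → n ∈ ⟦ hasBelow Y ⟧ → ∃[ m ] m < n × m ∈ ⟦ Y ⟧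
hasBelow⁻ Y (suc n) h with to (T-∨ {hasBelow Y n}) h
... | inj₁ below = let m , m<n , m∈Y = hasBelow⁻ Y n below in m , m<n⇒m<1+n m<n , m∈Y
... | inj₂ n∈Y   = n , n<1+n n , n∈Y

hasBelow⁺ : ∀ Y {m} n → m < n → m ∈ ⟦ Y ⟧ → n ∈ ⟦ hasBelow Y ⟧
hasBelow⁺ Y (suc n) m<1+n m∈Y with m≤n⇒m<n∨m≡n (s≤s⁻¹ m<1+n)
... | inj₁ m<n  = from (T-∨ {hasBelow Y n}) (inj₁ (hasBelow⁺ Y n m<n m∈Y))
... | inj₂ refl = from (T-∨ {hasBelow Y n}) (inj₂ m∈Y)

removeMin⊆ : ∀ Y → ⟦ removeMin Y ⟧ ⊆ ⟦ Y ⟧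
removeMin⊆ Y {n} = proj₁ ∘ to (T-∧ {Y n})

removeMin-infinite : ∀ Y → Infinite ⟦ Y ⟧ → Infinite ⟦ removeMin Y ⟧
removeMin-infinite Y inf n =
  let a , _ , a∈Y = inf 0
      -- Any element `a` of `Y`, least or not, certifies every later one, so it is enough to search
      -- beyond both `n` and `a`.
      m , bound≤m , m∈Y = inf (n ⊔ suc a)
      a<m = m⊔n≤o⇒n≤o n (suc a) bound≤m
  in m , m⊔n≤o⇒m≤o n (suc a) bound≤m , from (T-∧ {Y m}) (m∈Y , hasBelow⁺ Y m a<m a∈Y)

-- Otherwise each element of `Y` has a smaller one in `Y`, and well-founded induction empties `Y`.
Y⊈removeMin : ∀ Y → Infinite ⟦ Y ⟧ → ¬ (⟦ Y ⟧ ⊆ ⟦ removeMin Y ⟧)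
Y⊈removeMin Y inf Y⊆ =
  let a , _ , a∈Y = inf 0 in
  <-rec (λ n → ¬ (n ∈ ⟦ Y ⟧))
    (λ n rec n∈Y →
      let m , m<n , m∈Y = hasBelow⁻ Y n (proj₂ (to (T-∧ {Y n}) (Y⊆ n∈Y)))
      in rec m<n m∈Y)
    a a∈Y

bit : Bool → ℕ
bit b = if b then 1 else 0

zeros : ∀ {n} → Rec n
zeros = compᶠ zeroᶠ []

-- Here `precᶠ` only branches on the first bit: both steps ignore the counter and the recursive
-- value.
orᶠ andᶠ : Rec 2
orᶠ  = precᶠ (projᶠ 0F) (compᶠ sucᶠ (zeros ∷ []))
andᶠ = precᶠ zeros (projᶠ 2F)

hasBelowᶠ : Rec 1
-- The counter `0F` is the predecessor of the input, so the oracle is asked only strictly below it;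
-- `1F` is the recursive value.
hasBelowᶠ = precᶠ zeroᶠ (compᶠ orᶠ (projᶠ 1F ∷ compᶠ oracleᶠ (projᶠ 0F ∷ []) ∷ []))

removeMinᶠ : Functional
removeMinᶠ = compᶠ andᶠ (oracleᶠ ∷ hasBelowᶠ ∷ [])

⇓or : ∀ {A} b c → A ⊢ orᶠ [ bit b ∷ bit c ∷ [] ]⇓ bit (b ∨ c)
⇓or false c = ⇓prec₀ ⇓proj
-- The value at 0 is discarded, yet the big-step rule still demands its derivation.
⇓or true  c = ⇓prec₁ (⇓prec₀ ⇓proj) (⇓comp (⇓comp [] ⇓zero ∷ []) ⇓suc)

⇓and : ∀ {A} b c → A ⊢ andᶠ [ bit b ∷ bit c ∷ [] ]⇓ bit (b ∧ c)
⇓and false c = ⇓prec₀ (⇓comp [] ⇓zero)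
⇓and true  c = ⇓prec₁ (⇓prec₀ (⇓comp [] ⇓zero)) ⇓proj

hasBelowᶠ-computes : ∀ Y → hasBelowᶠ ⟪ Y ⟫≡ hasBelow Y
hasBelowᶠ-computes Y zero    = ⇓prec₀ ⇓zero
hasBelowᶠ-computes Y (suc n) =
  ⇓prec₁ (hasBelowᶠ-computes Y n)
    (⇓comp (⇓proj ∷ ⇓comp (⇓proj ∷ []) ⇓oracle ∷ []) (⇓or (hasBelow Y n) (Y n)))

removeMinᶠ-computes : ∀ Y → removeMinᶠ ⟪ Y ⟫≡ removeMin Y
removeMinᶠ-computes Y n =
  ⇓comp (⇓oracle ∷ hasBelowᶠ-computes Y n ∷ []) (⇓and (Y n) (hasBelow Y n))

free⇒thin : ∀ {B} (f : Coloring B) Ŷ →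
            Ŷ ∈ Problem.Solution (FS B) f → removeMin Ŷ ∈ Problem.Solution (TS B) f
free⇒thin {B} f Ŷ (inf , Ŷ⊆⋃B , free) =
  removeMin-infinite Ŷ inf , Ŷ⊆⋃B ∘ removeMin⊆ Ŷ , not-onto
  where
  not-onto : ¬ (image f (removeMin Ŷ) ≐ U)
  -- No omitted colour is named: surjectivity is applied at every `a` in `Ŷ`, and freeness then puts
  -- all of `Ŷ` inside `removeMin Ŷ`.
  not-onto (_ , onto) = Y⊈removeMin Ŷ inf λ a∈Ŷ → hit (onto tt) a∈Ŷ
    where
    hit : ∀ {a} → a ∈ image f (removeMin Ŷ) → a ∈ ⟦ Ŷ ⟧ → a ∈ ⟦ removeMin Ŷ ⟧
    hit (s , (s∈B , s⊆) , refl) a∈Ŷ = s⊆ (free s (s∈B , removeMin⊆ Ŷ ∘ s⊆) a∈Ŷ)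

theorem8 : (B : Pred FinSet 0ℓ) (X : Pred ℕ 0ℓ) → B IsBarrierOn X → TS B ≤sW FS B
theorem8 B X _ =
  oracleᶠ , removeMinᶠ , λ f p p-codes-f →
    f , p , (λ _ → ⇓oracle) , p-codes-f ,
    λ Ŷ Ŷ-free → removeMin Ŷ , removeMinᶠ-computes Ŷ , free⇒thin f Ŷ Ŷ-free
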